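{- If $\Phi\rhd\Gamma\vdash^{b}M:(\sigma,s)$ is a tight derivation, then there exists a $\lambda$-term $N$ such that $M\longrightarrow^{b}N$ and $\mathsf{normal}(N)$. Moreover, if $s=\mathsf{Neutral}$ then $\mathsf{neutral}(N)$.
   Context: Terms are untyped $\lambda$-terms modulo $\alpha$-equivalence, with Barendregt's variable convention. $M[N/x]$ is the usual substitution, and $M[x/x_1,x/x_2]$ means $(M[x/x_1])[x/x_2]$. **Normal forms and evaluation.** The predicates $\mathsf{neutral}$, $\mathsf{normal}$ are inductively defined by: $\mathsf{neutral}(x)$; if $\mathsf{neutral}(M)$ and $\mathsf{normal}(N)$ then $\mathsf{neutral}(MN)$; if $\mathsf{neutral}(M)$ then $\mathsf{normal}(M)$; if $\mathsf{normal}(M)$ then $\mathsf{normal}(\lambda x.M)$. $\mathsf{abs}(M)$ holds iff $M$ is an abstraction. Leftmost-outermost evaluation $\longrightarrow$ is inductively defined by: $(\lambda x.M)N\longrightarrow M[N/x]$; if $M\longrightarrow M'$ then $\lambda x.M\longrightarrow\lambda x.M'$; if $M\longrightarrow M'$ and $\neg\mathsf{abs}(M)$ then $MN\longrightarrow M'N$; if $\mathsf{neutral}(N)$ and $M\longrightarrow M'$ then $NM\longrightarrow NM'$. $\longrightarrow^b$ denotes exactly $b$ steps. **Types.** $\mathbb{V}$ is a countably infinite set of type variables $\alpha$. Linear types $\tau\in\mathbb{T}_{L0}$: $\tau::=\alpha\mid\tau\multimap\tau$. Sequences $\vec\tau\in\mathbb{T}_{L1}$: $\tau_1\cap\dots\cap\tau_m$,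 $m\ge1$. Linear rank 2 types $\sigma\in\mathbb{T}_{L2}$: $\sigma::=\tau\mid\tau\multimap\sigma\mid\tau_1\cap\dots\cap\tau_m\to\sigma$ with $m\ge2$. Multi-types: tight constants $\mathsf{tight}::=\mathsf{Neutral}\mid\mathsf{Abs}$; rank 0: $t::=\mathsf{tight}\mid\alpha\mid t\multimap t$; rank 1: $\vec t::=t\mid\vec t\cap\vec t$; rank 2: $s::=t\mid t\multimap s\mid\vec t\to s$. The constructor $\cap$ is associative, commutative and non-idempotent. $\mathsf{tight}(s)$ holds iff $s$ is a tight constant; $\mathsf{tight}(t_1\cap\dots\cap t_n)$ iff every $t_i$ is a tight constant. **Environments.** An environment is a finite list $\Gamma=[x_1:(\vec\tau_1,\vec t_1),\dots,x_n:(\vec\tau_n,\vec t_n)]$ with pairwise distinct variables $x_i$ (consistency), $\mathrm{dom}(\Gamma)=\{x_1,\dots,x_n\}$; $\mathsf{tight}(\Gamma)$ iff $\mathsf{tight}(\vec t_i)$ for all $i$. Comma is list concatenation. $\Gamma_1+\Gamma_2$ has domain $\mathrm{dom}(\Gamma_1)\cup\mathrm{dom}(\Gamma_2)$, agrees with $\Gamma_1$ (resp. $\Gamma_2$) on variables declared only there, and maps $x$ to $(\vec\tau_1\cap\vec\tau_2,\vec t_1\cap\vec t_2)$ if $\Gamma_j(x)=(\vec\tau_j,\vec t_j)$ for $j=1,2$; declarations of variables of $\Gamma_1$ come first in their order, then the remaining ones in the order of $\Gamma_2$. $\sum$ is iterated $+$. **Linear Rank 2 Quantitative Type System.** Judgments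 $\Gamma\vdash^{b}M:(\sigma,s)$, $b\in\mathbb{N}$, are derived by the following rules (all lists must be environments; each occurrence of $\mathsf{tight}$ stands for some tight constant): - (Axiom) $[x:(\tau,t)]\vdash^0x:(\tau,t)$. - (Exchange) two adjacent declarations of the environment may be swapped, keeping $b,M,\sigma,s$. - (Contraction) from $\Gamma_1,x_1:(\vec\tau_1,\vec t_1),x_2:(\vec\tau_2,\vec t_2),\Gamma_2\vdash^bM:(\sigma,s)$ infer $\Gamma_1,x:(\vec\tau_1\cap\vec\tau_2,\vec t_1\cap\vec t_2),\Gamma_2\vdash^bM[x/x_1,x/x_2]:(\sigma,s)$. - ($\multimap$ Intro) from $\Gamma,x:(\tau,t)\vdash^bM:(\sigma,s)$ infer $\Gamma\vdash^{b+1}\lambda x.M:(\tau\multimap\sigma,t\multimap s)$. - ($\multimap$ Intro$_t$) from $\Gamma,x:(\tau,\mathsf{tight})\vdash^bM:(\sigma,\mathsf{tight})$ infer $\Gamma\vdash^b\lambda x.M:(\tau\multimap\sigma,\mathsf{Abs})$. - ($\to$ Intro) from $\Gamma,x:(\tau_1\cap\dots\cap\tau_n,t_1\cap\dots\cap t_n)\vdash^bM:(\sigma,s)$, $n\ge2$, infer $\Gamma\vdash^{b+1}\lambda x.M:(\tau_1\cap\dots\cap\tau_n\to\sigma,t_1\cap\dots\cap t_n\to s)$. - ($\to$ Intro$_t$) from $\Gamma,x:(\tau_1\cap\dots\cap\tau_n,\vec t)\vdash^bM:(\sigma,\mathsf{tight})$, $\mathsf{tight}(\vec t)$, $n\ge2$,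 infer $\Gamma\vdash^b\lambda x.M:(\tau_1\cap\dots\cap\tau_n\to\sigma,\mathsf{Abs})$. - ($\multimap$ Elim) from $\Gamma_1\vdash^{b_1}M_1:(\tau\multimap\sigma,t\multimap s)$ and $\Gamma_2\vdash^{b_2}M_2:(\tau,t)$ infer $\Gamma_1,\Gamma_2\vdash^{b_1+b_2}M_1M_2:(\sigma,s)$. - ($\multimap$ Elim$_t$) from $\Gamma_1\vdash^{b_1}M_1:(\tau\multimap\sigma,\mathsf{Neutral})$ and $\Gamma_2\vdash^{b_2}M_2:(\tau,\mathsf{tight})$ infer $\Gamma_1,\Gamma_2\vdash^{b_1+b_2}M_1M_2:(\sigma,\mathsf{Neutral})$. - ($\to$ Elim) from $\Gamma\vdash^bM_1:(\tau_1\cap\dots\cap\tau_n\to\sigma,t_1\cap\dots\cap t_n\to s)$ and $\Gamma_i\vdash^{b_i}M_2:(\tau_i,t_i)$ for $1\le i\le n$, $n\ge2$, infer $\Gamma,\sum_{i=1}^n\Gamma_i\vdash^{b+b_1+\dots+b_n}M_1M_2:(\sigma,s)$. - ($\to$ Elim$_t$) from $\Gamma\vdash^bM_1:(\tau_1\cap\dots\cap\tau_n\to\sigma,\mathsf{Neutral})$ and $\Gamma_i\vdash^{b_i}M_2:(\tau_i,\mathsf{tight})$ for $1\le i\le n$, $n\ge2$, infer $\Gamma,\sum_{i=1}^n\Gamma_i\vdash^{b+b_1+\dots+b_n}M_1M_2:(\sigma,\mathsf{Neutral})$. $\Phi\rhd\Gamma\vdash^bM:(\sigma,s)$ means that $\Phi$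 is a derivation tree ending with that judgment. It is tight if $\mathsf{tight}(s)$ and $\mathsf{tight}(\Gamma)$. -}

module Defs where

open import Data.Fin.Base using (Fin; inject₁; fromℕ)
open import Data.List.Base using (List; []; _∷_; _++_; map; filter)
open import Data.List.Membership.DecPropositional using (_∈?_)
open import Data.List.NonEmpty.Base using (List⁺; toList; fromVec; _⁺++⁺_) renaming ([_] to [_]⁺)
open import Data.List.Relation.Binary.Permutation.Propositional using (_↭_)
open import Data.List.Relation.Binary.Pointwise using (Pointwise)
open import Data.List.Relation.Unary.All using (All)
open import Data.List.Relation.Unary.Unique.Propositional using (Unique)
open import Data.Maybe.Base using (Maybe; just; nothing; maybe′)
open import Data.Nat.Base using (ℕ; zero; suc; _+_)
open import Data.Nat.Properties using (_≟_)
open import Data.Product.Base using (_×_; _,_; proj₁; ∃₂)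
open import Data.Vec.Base as Vec using (Vec; lookup)
open import Relation.Binary.PropositionalEquality using (_≡_)
open import Relation.Nullary using (¬_; yes; no; ¬?)

------------------------------------------------------------------------
-- λ-terms modulo α-equivalence

Var : Set
Var = ℕ

-- Locally nameless syntax: free variables are named, and Term n has at most
-- n dangling bound variables.  The inhabitants of Term 0 are exactly the
-- α-equivalence classes of λ-terms, so that _≡_ on Λ is α-equivalence.
data Term (n : ℕ) : Set where
  fv  : Var → Term n
  bv  : Fin n → Term n
  lam : Term (suc n) → Term n
  _·_ : Term n → Term n → Term n

infixl 20 _·_

Λ : Set
Λ = Term 0

-- In Term n the index fromℕ (n - 1) refers to the outermost dangling binder
-- and index 0 to the innermost one.  Adding a new outermost dangling binder
-- therefore changes no index.
weaken : ∀ {n} → Term n → Term (suc n)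
weaken (fv x)  = fv x
weaken (bv i)  = bv (inject₁ i)
weaken (lam M) = lam (weaken M)
weaken (M · N) = weaken M · weaken N

-- Bind the free variable x by a new outermost dangling binder.
close : ∀ {n} → Var → Term n → Term (suc n)
close {n} x (fv y) with x ≟ y
... | yes _ = bv (fromℕ n)
... | no  _ = fv y
close x (bv i)  = bv (inject₁ i)
close x (lam M) = lam (close x M)
close x (M · N) = close x M · close x N

-- The named abstraction λx.M.
ƛ : Var → Λ → Λ
ƛ x M = lam (close x M)

-- A term of Λ has no dangling indices, so it can be placed under any number
-- of binders unchanged.
embed : ∀ {n} → Λ → Term n
embed {zero}  N = N
embed {suc n} N = weaken (embed N)

-- M [ N / x ] substitutes N for x in M.
infixl 30 _[_/_]

_[_/_] : ∀ {n} → Term n → Λ → Var → Term n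
fv y [ N / x ] with x ≟ y
... | yes _ = embed N
... | no  _ = fv y
bv i    [ N / x ] = bv i
lam M   [ N / x ] = lam (M [ N / x ])
(M · P) [ N / x ] = (M [ N / x ]) · (P [ N / x ])

------------------------------------------------------------------------
-- Normal forms and leftmost-outermost evaluation

data neutral : Λ → Set
data normal  : Λ → Set

data neutral where
  var : ∀ {x} → neutral (fv x)
  app : ∀ {M N} → neutral M → normal N → neutral (M · N)

data normal where
  ne  : ∀ {M} → neutral M → normal M
  abs : ∀ {x M} → normal M → normal (ƛ x M)

IsAbs : Λ → Set
IsAbs M = ∃₂ λ x M′ → M ≡ ƛ x M′

infix 4 _⟶_ _⟶[_]_

data _⟶_ : Λ → Λ → Set where
  β  : ∀ {x M N} → ƛ x M · N ⟶ M [ N / x ]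
  ξ  : ∀ {x M M′} → M ⟶ M′ → ƛ x M ⟶ ƛ x M′
  μ  : ∀ {M M′ N} → M ⟶ M′ → ¬ IsAbs M → M · N ⟶ M′ · N
  ν  : ∀ {N M M′} → neutral N → M ⟶ M′ → N · M ⟶ N · M′

data _⟶[_]_ : Λ → ℕ → Λ → Set where
  done : ∀ {M} → M ⟶[ 0 ] M
  step : ∀ {M M′ N b} → M ⟶ M′ → M′ ⟶[ b ] N → M ⟶[ suc b ] N

------------------------------------------------------------------------
-- Types

TVar : Set
TVar = ℕ

data Rank : Set where
  rank0 rank2 : Rank

infixr 25 _⊸_ _⇒_

-- LinTy rank0 is 𝕋_L0 and LinTy rank2 is 𝕋_L2.  The domain of _⇒_ is
-- τ₁ ∩ ⋯ ∩ τₘ with m = 2 + k ≥ 2.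
data LinTy : Rank → Set where
  ‵_  : ∀ {r} → TVar → LinTy r
  _⊸_ : ∀ {r} → LinTy rank0 → LinTy r → LinTy r
  _⇒_ : ∀ {k} → Vec (LinTy rank0) (2 + k) → LinTy rank2 → LinTy rank2

-- Multi-types of rank 0 (t) and of rank 2 (s).
data MTy : Rank → Set where
  Neutral Abs : ∀ {r} → MTy r
  ‵_  : ∀ {r} → TVar → MTy r
  _⊸_ : ∀ {r} → MTy rank0 → MTy r → MTy r
  _⇒_ : List⁺ (MTy rank0) → MTy rank2 → MTy rank2

-- The inclusions of rank 0 into rank 2.
↑ˡ : LinTy rank0 → LinTy rank2
↑ˡ (‵ α)   = ‵ α
↑ˡ (τ ⊸ σ) = τ ⊸ ↑ˡ σ

↑ᵐ : MTy rank0 → MTy rank2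
↑ᵐ Neutral = Neutral
↑ᵐ Abs     = Abs
↑ᵐ (‵ α)   = ‵ α
↑ᵐ (t ⊸ s) = t ⊸ ↑ᵐ s

-- Rank 1: non-empty sequences τ₁ ∩ ⋯ ∩ τₘ and t₁ ∩ ⋯ ∩ tₘ.
LinSeq MSeq : Set
LinSeq = List⁺ (LinTy rank0)
MSeq   = List⁺ (MTy rank0)

infixr 26 _∩_

_∩_ : {A : Set} → List⁺ A → List⁺ A → List⁺ A
_∩_ = _⁺++⁺_

-- Types are identified modulo associativity and commutativity of ∩.  With
-- sequences as lists associativity is built in, and commutativity is
-- permutation; rank 0 types contain no ∩, so on them this is _≡_.
infix 4 _≈¹_ _≈ˡ_ _≈ᵐ_ _≈ᵉ_

_≈¹_ : {A : Set} → List⁺ A → List⁺ A → Set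
xs ≈¹ ys = toList xs ↭ toList ys

data _≈ˡ_ : LinTy rank2 → LinTy rank2 → Set where
  var : ∀ {α} → ‵ α ≈ˡ ‵ α
  lin : ∀ {τ σ σ′} → σ ≈ˡ σ′ → τ ⊸ σ ≈ˡ τ ⊸ σ′
  arr : ∀ {k k′} {τs : Vec (LinTy rank0) (2 + k)} {τs′ : Vec (LinTy rank0) (2 + k′)} {σ σ′} →
        fromVec τs ≈¹ fromVec τs′ → σ ≈ˡ σ′ → τs ⇒ σ ≈ˡ τs′ ⇒ σ′

data _≈ᵐ_ : MTy rank2 → MTy rank2 → Set where
  neu : Neutral ≈ᵐ Neutral
  abs : Abs ≈ᵐ Abs
  var : ∀ {α} → ‵ α ≈ᵐ ‵ α
  lin : ∀ {t s s′} → s ≈ᵐ s′ → t ⊸ s ≈ᵐ t ⊸ s′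
  arr : ∀ {ts ts′ s s′} → ts ≈¹ ts′ → s ≈ᵐ s′ → ts ⇒ s ≈ᵐ ts′ ⇒ s′

data tight {r : Rank} : MTy r → Set where
  neu : tight Neutral
  abs : tight Abs

------------------------------------------------------------------------
-- Environments

infix 5 _∶_,_

data Decl : Set where
  _∶_,_ : Var → LinSeq → MSeq → Decl

Env : Set
Env = List Decl

name : Decl → Var
name (x ∶ _ , _) = x

dom : Env → List Var
dom = map name

Consistent : Env → Set
Consistent Γ = Unique (dom Γ)

tightDecl : Decl → Set
tightDecl (_ ∶ _ , ts) = All tight (toList ts)

tightEnv : Env → Set
tightEnv = All tightDecl

data _≈ᵈ_ : Decl → Decl → Set where
  decl : ∀ {x τs τs′ ts ts′} → τs ≈¹ τs′ → ts ≈¹ ts′ →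
         (x ∶ τs , ts) ≈ᵈ (x ∶ τs′ , ts′)

_≈ᵉ_ : Env → Env → Set
_≈ᵉ_ = Pointwise _≈ᵈ_

find : Var → Env → Maybe (LinSeq × MSeq)
find x [] = nothing
find x ((y ∶ τs , ts) ∷ Γ) with x ≟ y
... | yes _ = just (τs , ts)
... | no  _ = find x Γ

extend : Env → Decl → Decl
extend Γ (x ∶ τs , ts) =
  maybe′ (λ (τs′ , ts′) → x ∶ τs ∩ τs′ , ts ∩ ts′) (x ∶ τs , ts) (find x Γ)

infixl 6 _⊕_

-- The sum Γ₁ + Γ₂.
_⊕_ : Env → Env → Env
Γ₁ ⊕ Γ₂ = map (extend Γ₂) Γ₁ ++ filter (λ d → ¬? (_∈?_ _≟_ (name d) (dom Γ₁))) Γ₂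

-- [] is a unit of _⊕_.
∑ : ∀ {n} → Vec Env n → Env
∑ = Vec.foldr′ _⊕_ []

------------------------------------------------------------------------
-- The type system

infix 3 _⊢[_]_∶⟨_,_⟩

-- Consistency of the environment is demanded in the rules whose conclusion
-- does not inherit it from the premises.  The rule conv carries no content:
-- it states that types are taken modulo associativity and commutativity of ∩.
data _⊢[_]_∶⟨_,_⟩ : Env → ℕ → Λ → LinTy rank2 → MTy rank2 → Set where

  conv : ∀ {Γ Γ′ b M σ σ′ s s′} →
    Γ ≈ᵉ Γ′ → σ ≈ˡ σ′ → s ≈ᵐ s′ →
    Γ ⊢[ b ] M ∶⟨ σ , s ⟩ →
    Γ′ ⊢[ b ] M ∶⟨ σ′ , s′ ⟩

  axiom : ∀ {x τ t} →
    (x ∶ [ τ ]⁺ , [ t ]⁺) ∷ [] ⊢[ 0 ] fv x ∶⟨ ↑ˡ τ , ↑ᵐ t ⟩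

  exchange : ∀ {Γ₁ Γ₂ d₁ d₂ b M σ s} →
    Γ₁ ++ d₁ ∷ d₂ ∷ Γ₂ ⊢[ b ] M ∶⟨ σ , s ⟩ →
    Γ₁ ++ d₂ ∷ d₁ ∷ Γ₂ ⊢[ b ] M ∶⟨ σ , s ⟩

  contraction : ∀ {Γ₁ Γ₂ x x₁ x₂ τs₁ τs₂ ts₁ ts₂ b M σ s} →
    Γ₁ ++ (x₁ ∶ τs₁ , ts₁) ∷ (x₂ ∶ τs₂ , ts₂) ∷ Γ₂ ⊢[ b ] M ∶⟨ σ , s ⟩ →
    Consistent (Γ₁ ++ (x ∶ τs₁ ∩ τs₂ , ts₁ ∩ ts₂) ∷ Γ₂) →
    Γ₁ ++ (x ∶ τs₁ ∩ τs₂ , ts₁ ∩ ts₂) ∷ Γ₂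
      ⊢[ b ] M [ fv x / x₁ ] [ fv x / x₂ ] ∶⟨ σ , s ⟩

  ⊸-intro : ∀ {Γ x τ t b M σ s} →
    Γ ++ (x ∶ [ τ ]⁺ , [ t ]⁺) ∷ [] ⊢[ b ] M ∶⟨ σ , s ⟩ →
    Γ ⊢[ suc b ] ƛ x M ∶⟨ τ ⊸ σ , t ⊸ s ⟩

  ⊸-introₜ : ∀ {Γ x τ t b M σ s} →
    Γ ++ (x ∶ [ τ ]⁺ , [ t ]⁺) ∷ [] ⊢[ b ] M ∶⟨ σ , s ⟩ →
    tight t → tight s →
    Γ ⊢[ b ] ƛ x M ∶⟨ τ ⊸ σ , Abs ⟩

  →-intro : ∀ {k Γ x b M σ s} {τs : Vec (LinTy rank0) (2 + k)} {ts : Vec (MTy rank0) (2 + k)} →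
    Γ ++ (x ∶ fromVec τs , fromVec ts) ∷ [] ⊢[ b ] M ∶⟨ σ , s ⟩ →
    Γ ⊢[ suc b ] ƛ x M ∶⟨ τs ⇒ σ , fromVec ts ⇒ s ⟩

  →-introₜ : ∀ {k Γ x ts b M σ s} {τs : Vec (LinTy rank0) (2 + k)} →
    Γ ++ (x ∶ fromVec τs , ts) ∷ [] ⊢[ b ] M ∶⟨ σ , s ⟩ →
    All tight (toList ts) → tight s →
    Γ ⊢[ b ] ƛ x M ∶⟨ τs ⇒ σ , Abs ⟩

  ⊸-elim : ∀ {Γ₁ Γ₂ b₁ b₂ M₁ M₂ τ t σ s} →
    Γ₁ ⊢[ b₁ ] M₁ ∶⟨ τ ⊸ σ , t ⊸ s ⟩ →
    Γ₂ ⊢[ b₂ ] M₂ ∶⟨ ↑ˡ τ , ↑ᵐ t ⟩ →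
    Consistent (Γ₁ ++ Γ₂) →
    Γ₁ ++ Γ₂ ⊢[ b₁ + b₂ ] M₁ · M₂ ∶⟨ σ , s ⟩

  ⊸-elimₜ : ∀ {Γ₁ Γ₂ b₁ b₂ M₁ M₂ τ t σ} →
    Γ₁ ⊢[ b₁ ] M₁ ∶⟨ τ ⊸ σ , Neutral ⟩ →
    Γ₂ ⊢[ b₂ ] M₂ ∶⟨ ↑ˡ τ , t ⟩ →
    tight t →
    Consistent (Γ₁ ++ Γ₂) →
    Γ₁ ++ Γ₂ ⊢[ b₁ + b₂ ] M₁ · M₂ ∶⟨ σ , Neutral ⟩

  →-elim : ∀ {k Γ b M₁ M₂ σ s}
    {τs : Vec (LinTy rank0) (2 + k)} {ts : Vec (MTy rank0) (2 + k)}
    {Γs : Vec Env (2 + k)} {bs : Vec ℕ (2 + k)} →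
    Γ ⊢[ b ] M₁ ∶⟨ τs ⇒ σ , fromVec ts ⇒ s ⟩ →
    (∀ i → lookup Γs i ⊢[ lookup bs i ] M₂ ∶⟨ ↑ˡ (lookup τs i) , ↑ᵐ (lookup ts i) ⟩) →
    Consistent (Γ ++ ∑ Γs) →
    Γ ++ ∑ Γs ⊢[ b + Vec.sum bs ] M₁ · M₂ ∶⟨ σ , s ⟩

  →-elimₜ : ∀ {k Γ b M₁ M₂ σ}
    {τs : Vec (LinTy rank0) (2 + k)} {ts : Vec (MTy rank2) (2 + k)}
    {Γs : Vec Env (2 + k)} {bs : Vec ℕ (2 + k)} →
    Γ ⊢[ b ] M₁ ∶⟨ τs ⇒ σ , Neutral ⟩ →
    (∀ i → lookup Γs i ⊢[ lookup bs i ] M₂ ∶⟨ ↑ˡ (lookup τs i) , lookup ts i ⟩) →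
    (∀ i → tight (lookup ts i)) →
    Consistent (Γ ++ ∑ Γs) →
    Γ ++ ∑ Γs ⊢[ b + Vec.sum bs ] M₁ · M₂ ∶⟨ σ , Neutral ⟩

TightDerivation : ∀ {Γ b M σ s} → Γ ⊢[ b ] M ∶⟨ σ , s ⟩ → Set
TightDerivation {Γ} {s = s} _ = tight s × tightEnv Γ

{-# OPTIONS --safe #-}
module Submission where

-- A variable has a linear type of rank 0, hence so does every term of
-- multi-type Neutral (more generally, the part of σ that corresponds to a
-- target Neutral of s is of rank 0).  So the rule →-elimₜ, which would charge
-- the steps of its argument several times, is never applicable.  The linear
-- types have no further role, and what remains is a tight multi-type system.
-- There, a term with a tight derivation is either normal with counter 0, or its
-- leftmost-outermost reduct is typable with the same types and a counter
-- smaller by one.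

open import Defs
open import Algebra.Bundles using (CommutativeMonoid)
open import Algebra.Construct.DirectProduct using (commutativeMonoid)
import Algebra.Properties.CommutativeSemigroup as CommutativeSemigroupProperties
open import Data.Empty using (⊥; ⊥-elim)
open import Data.Fin.Base using (Fin; zero; suc; inject₁; fromℕ)
open import Data.List.Base using (List; []; _∷_; _++_; map; filter; concatMap)
open import Data.List.Membership.DecPropositional using (_∈?_)
open import Data.List.Membership.Propositional using (_∈_; _∉_)
open import Data.List.NonEmpty.Base using (toList; fromVec)
open import Data.List.Properties using (map-++; map-id; map-∘; map-cong; concatMap-++; ++-assoc; ++-identityʳ)
open import Data.List.Relation.Binary.Permutation.Propositional
  using (_↭_; ↭-refl; ↭-sym; ↭-trans; ↭-reflexive; prep; swap; ↭⇒↭ₛ)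
open import Data.List.Relation.Binary.Permutation.Propositional.Properties as Perm
  using (map⁺; ++⁺; ++⁺ˡ; ++⁺ʳ; shift; shifts; All-resp-↭; ++-commutativeMonoid)
open import Data.List.Relation.Binary.Pointwise using ([]; _∷_)
open import Data.List.Relation.Unary.All as All using (All; []; _∷_)
import Data.List.Relation.Unary.All.Properties as All
import Data.List.Relation.Unary.AllPairs.Properties as AllPairs
import Data.List.Relation.Unary.Unique.Propositional.Properties as Unique
import Data.List.Relation.Binary.Permutation.Setoid.Properties as PermSetoid
open import Data.List.Membership.Propositional.Properties using (∈-map⁻; ∈-filter⁻)
open import Data.List.Relation.Unary.AllPairs using ([]; _∷_)
open import Data.List.Relation.Unary.Any using (here; there)
open import Data.List.Relation.Unary.Unique.Propositional using (Unique)
open import Data.Maybe.Base using (just; nothing)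
open import Data.Nat.Base using (ℕ; zero; suc; _+_; _≤_; s≤s; _⊔_)
open import Data.Nat.Properties as ℕ using (_≟_; +-0-commutativeMonoid)
open import Data.Product.Base using (_×_; _,_; proj₂; ∃₂; ∃-syntax; map₁)
open import Data.Sum.Base using (_⊎_; inj₁; inj₂)
open import Data.Unit.Base using (⊤; tt)
open import Data.Vec.Base as Vec using (Vec; lookup; []; _∷_)
open import Function.Base using (_∘_; id)
open import Relation.Binary.PropositionalEquality
  using (_≡_; _≢_; refl; sym; trans; cong; cong₂; subst; subst₂; _≗_; setoid; module ≡-Reasoning)
open import Relation.Nullary using (¬_; Dec; yes; no; ¬?; contradiction)

-- Renaming of atoms

-- Free names and dangling indices are treated alike, so that weakening, closing, opening and
-- replacing a variable by a variable are all instances of `ren`.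
Atom : ℕ → Set
Atom n = Var ⊎ Fin n

private variable
  n m k : ℕ

atom : Atom n → Term n
atom (inj₁ x) = fv x
atom (inj₂ i) = bv i

bump : Atom n → Atom (suc n)
bump (inj₁ x) = inj₁ x
bump (inj₂ i) = inj₂ (suc i)

lift : (Atom n → Atom m) → Atom (suc n) → Atom (suc m)
lift ρ (inj₁ x)       = bump (ρ (inj₁ x))
lift ρ (inj₂ zero)    = inj₂ zero
lift ρ (inj₂ (suc i)) = bump (ρ (inj₂ i))

ren : (Atom n → Atom m) → Term n → Term m
ren ρ (fv x)  = atom (ρ (inj₁ x))
ren ρ (bv i)  = atom (ρ (inj₂ i))
ren ρ (lam M) = lam (ren (lift ρ) M)
ren ρ (M · N) = ren ρ M · ren ρ N

ren-atom : (ρ : Atom n → Atom m) (a : Atom n) → ren ρ (atom a) ≡ atom (ρ a)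
ren-atom ρ (inj₁ x) = refl
ren-atom ρ (inj₂ i) = refl

lift-cong : {ρ ρ′ : Atom n → Atom m} → ρ ≗ ρ′ → lift ρ ≗ lift ρ′
lift-cong eq (inj₁ x)       = cong bump (eq (inj₁ x))
lift-cong eq (inj₂ zero)    = refl
lift-cong eq (inj₂ (suc i)) = cong bump (eq (inj₂ i))

ren-cong : {ρ ρ′ : Atom n → Atom m} → ρ ≗ ρ′ → ren ρ ≗ ren ρ′
ren-cong eq (fv x)  = cong atom (eq (inj₁ x))
ren-cong eq (bv i)  = cong atom (eq (inj₂ i))
ren-cong eq (lam M) = cong lam (ren-cong (lift-cong eq) M)
ren-cong eq (M · N) = cong₂ _·_ (ren-cong eq M) (ren-cong eq N)

lift-bump : (ρ : Atom n → Atom m) (a : Atom n) → lift ρ (bump a) ≡ bump (ρ a)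
lift-bump ρ (inj₁ x) = refl
lift-bump ρ (inj₂ i) = refl

lift-∘ : (ρ : Atom m → Atom k) (ρ′ : Atom n → Atom m) → lift ρ ∘ lift ρ′ ≗ lift (ρ ∘ ρ′)
lift-∘ ρ ρ′ (inj₁ x)       = lift-bump ρ (ρ′ (inj₁ x))
lift-∘ ρ ρ′ (inj₂ zero)    = refl
lift-∘ ρ ρ′ (inj₂ (suc i)) = lift-bump ρ (ρ′ (inj₂ i))

ren-∘ : (ρ : Atom m → Atom k) (ρ′ : Atom n → Atom m) (M : Term n) →
        ren ρ (ren ρ′ M) ≡ ren (ρ ∘ ρ′) M
ren-∘ ρ ρ′ (fv x)  = ren-atom ρ (ρ′ (inj₁ x))
ren-∘ ρ ρ′ (bv i)  = ren-atom ρ (ρ′ (inj₂ i))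
ren-∘ ρ ρ′ (lam M) = cong lam (trans (ren-∘ (lift ρ) (lift ρ′) M) (ren-cong (lift-∘ ρ ρ′) M))
ren-∘ ρ ρ′ (M · N) = cong₂ _·_ (ren-∘ ρ ρ′ M) (ren-∘ ρ ρ′ N)

-- Fresh names and the size of terms

Fresh : Var → Term n → Set
Fresh x (fv y)  = x ≢ y
Fresh x (bv i)  = ⊤
Fresh x (lam M) = Fresh x M
Fresh x (M · N) = Fresh x M × Fresh x N

-- The value of `ρ` at `x` is left free since `x` does not occur in `M`. In `close-open` the
-- renaming captures exactly this name.
ren-id : {ρ : Atom n → Atom n} {x : Var} (M : Term n) → Fresh x M →
         (∀ y → x ≢ y → ρ (inj₁ y) ≡ inj₁ y) → (∀ i → ρ (inj₂ i) ≡ inj₂ i) → ren ρ M ≡ M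
ren-id (fv y)  x♯y f g = cong atom (f y x♯y)
ren-id (bv i)  _ f g = cong atom (g i)
ren-id (lam M) x♯M f g = cong lam (ren-id M x♯M (λ y x≢y → cong bump (f y x≢y))
  λ { zero → refl ; (suc i) → cong bump (g i) })
ren-id (M · N) (x♯M , x♯N) f g = cong₂ _·_ (ren-id M x♯M f g) (ren-id N x♯N f g)

eventuallyFresh : (M : Term n) → ∃[ b ] (∀ x → b ≤ x → Fresh x M)
eventuallyFresh (fv y)  = suc y , λ { x y<x refl → ℕ.<-irrefl refl y<x }
eventuallyFresh (bv i)  = 0 , λ _ _ → tt
eventuallyFresh (lam M) = eventuallyFresh M
eventuallyFresh (M · N) with eventuallyFresh M | eventuallyFresh N
... | b , f | c , g = b ⊔ c , λ x p → f x (ℕ.m⊔n≤o⇒m≤o b c p) , g x (ℕ.m⊔n≤o⇒n≤o b c p)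

size : Term n → ℕ
size (fv x)  = 0
size (bv i)  = 0
size (lam M) = suc (size M)
size (M · N) = suc (size M + size N)

-- Atoms have size 0, so opening the body of an abstraction keeps its size and recursion on size can
-- enter the opened body.
size-ren : (ρ : Atom n → Atom m) (M : Term n) → size (ren ρ M) ≡ size M
size-ren ρ (fv x) with ρ (inj₁ x)
... | inj₁ _ = refl
... | inj₂ _ = refl
size-ren ρ (bv i) with ρ (inj₂ i)
... | inj₁ _ = refl
... | inj₂ _ = refl
size-ren ρ (lam M) = cong suc (size-ren (lift ρ) M)
size-ren ρ (M · N) = cong suc (cong₂ _+_ (size-ren ρ M) (size-ren ρ N))

-- The operations of the paper's syntax as renamings

weakenAtom : Atom n → Atom (suc n)
weakenAtom (inj₁ x) = inj₁ x
weakenAtom (inj₂ i) = inj₂ (inject₁ i)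

-- The new binder is the outermost one, so passing under an inner binder changes nothing:
-- `lift weakenAtom` agrees with `weakenAtom`.
weaken-ren : (M : Term n) → weaken M ≡ ren weakenAtom M
weaken-ren (fv x)  = refl
weaken-ren (bv i)  = refl
weaken-ren (lam M) = cong lam (trans (weaken-ren M) (ren-cong eq M))
  where
  eq : weakenAtom ≗ lift weakenAtom
  eq (inj₁ x)       = refl
  eq (inj₂ zero)    = refl
  eq (inj₂ (suc i)) = refl
weaken-ren (M · N) = cong₂ _·_ (weaken-ren M) (weaken-ren N)

embedAtom : Atom 0 → Atom n
embedAtom (inj₁ x) = inj₁ x

embed-ren : (N : Λ) → embed {n} N ≡ ren embedAtom N
embed-ren {zero}  N = sym (ren-id N (proj₂ (eventuallyFresh N) _ ℕ.≤-refl) (λ _ _ → refl) λ ())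
embed-ren {suc n} N = trans (weaken-ren (embed N))
  (trans (cong (ren weakenAtom) (embed-ren N)) (trans (ren-∘ weakenAtom embedAtom N) (ren-cong eq N)))
  where
  eq : weakenAtom ∘ embedAtom ≗ embedAtom
  eq (inj₁ x) = refl

closeAtom : Var → Atom n → Atom (suc n)
closeAtom {n} x (inj₁ y) with x ≟ y
... | yes _ = inj₂ (fromℕ n)
... | no  _ = inj₁ y
closeAtom x (inj₂ i) = inj₂ (inject₁ i)

close-ren : (x : Var) (M : Term n) → close x M ≡ ren (closeAtom x) M
close-ren x (fv y) with x ≟ y
... | yes _ = refl
... | no  _ = refl
close-ren x (bv i)  = refl
close-ren x (lam M) = cong lam (trans (close-ren x M) (ren-cong eq M))
  where
  eq : closeAtom x ≗ lift (closeAtom x)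
  eq (inj₁ y) with x ≟ y
  ... | yes _ = refl
  ... | no  _ = refl
  eq (inj₂ zero)    = refl
  eq (inj₂ (suc i)) = refl
close-ren x (M · N) = cong₂ _·_ (close-ren x M) (close-ren x N)

replace : Var → Var → Var → Var
replace x y z with y ≟ z
... | yes _ = x
... | no  _ = z

replaceAtom : Var → Var → Atom n → Atom n
replaceAtom x y (inj₁ z) = inj₁ (replace x y z)
replaceAtom x y (inj₂ i) = inj₂ i

replace-ren : (x y : Var) (M : Term n) → M [ fv x / y ] ≡ ren (replaceAtom x y) M
replace-ren x y (fv z) with y ≟ z
... | yes _ = embed-ren (fv x)
... | no  _ = refl
replace-ren x y (bv i)  = refl
replace-ren x y (lam M) = cong lam (trans (replace-ren x y M) (ren-cong eq M))
  where
  eq : replaceAtom x y ≗ lift (replaceAtom x y)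
  eq (inj₁ y)       = refl
  eq (inj₂ zero)    = refl
  eq (inj₂ (suc i)) = refl
replace-ren x y (M · N) = cong₂ _·_ (replace-ren x y M) (replace-ren x y N)

openAtom : Var → Atom 1 → Atom 0
openAtom x (inj₁ y) = inj₁ y
openAtom x (inj₂ zero) = inj₁ x

closeAtom-≡ : (x : Var) → closeAtom {n} x (inj₁ x) ≡ inj₂ (fromℕ n)
closeAtom-≡ x with x ≟ x
... | yes _  = refl
... | no x≢x = contradiction refl x≢x

closeAtom-≢ : {x y : Var} → x ≢ y → closeAtom {n} x (inj₁ y) ≡ inj₁ y
closeAtom-≢ {x = x} {y} x≢y with x ≟ y
... | yes x≡y = contradiction x≡y x≢y
... | no  _   = refl

-- The composite renaming sends the only index to `x` and back, and fixes every name other than `x`.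
close-open : (x : Var) (M : Term 1) → Fresh x M → close x (ren (openAtom x) M) ≡ M
close-open x M x♯M = trans (close-ren x (ren (openAtom x) M)) (trans (ren-∘ (closeAtom x) (openAtom x) M)
  (ren-id M x♯M (λ _ x≢y → closeAtom-≢ x≢y) λ { zero → closeAtom-≡ x }))

-- `N` has no dangling indices, so shifting its embedding gives its embedding one level deeper. This
-- carries derivations for the substituted term under a binder.
bump-[/] : (N : Λ) (x : Var) (a : Atom n) →
           ren bump (atom a [ N / x ]) ≡ atom (bump a) [ N / x ]
bump-[/] N x (inj₁ y) with x ≟ y
... | yes _ = trans (cong (ren bump) (embed-ren N))
  (trans (ren-∘ bump embedAtom N) (trans (ren-cong eq N) (sym (embed-ren N))))
  where
  eq : bump ∘ embedAtom ≗ embedAtom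
  eq (inj₁ _) = refl
... | no  _ = refl
bump-[/] N x (inj₂ i) = refl

-- Typing with explicit resources

Ctx : ℕ → Set
Ctx n = List (Atom n × MTy rank0)

-- A resource is a context, taken up to permutation and listing one entry per
-- occurrence of an atom, together with a number of steps.
resources : ℕ → CommutativeMonoid _ _
resources n = commutativeMonoid (++-commutativeMonoid {A = Atom n × MTy rank0}) +-0-commutativeMonoid

open module Resource {n} = CommutativeMonoid (resources n)
  using (_≈_; _∙_; ε; ∙-congˡ; ∙-congʳ; identityˡ; identityʳ; assoc; comm)
  renaming (Carrier to ResourceOf; refl to ≈-refl; sym to ≈-sym; trans to ≈-trans)

open module ResourceProperties {n} =
  CommutativeSemigroupProperties (Resource.commutativeSemigroup {n})
  using (interchange; x∙yz≈y∙xz)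

Res : ℕ → Set
Res n = ResourceOf {n}

steps : ℕ → Res n
steps b = [] , b

rename : (Atom n → Atom m) → Res n → Res m
rename ρ (Γ , b) = map (map₁ ρ) Γ , b

rename-≈ : (ρ : Atom n → Atom m) {r r′ : Res n} → r ≈ r′ → rename ρ r ≈ rename ρ r′
rename-≈ ρ (p , q) = map⁺ (map₁ ρ) p , q

rename-∙ : (ρ : Atom n → Atom m) (r r′ : Res n) → rename ρ (r ∙ r′) ≈ rename ρ r ∙ rename ρ r′
rename-∙ ρ (Γ , b) (Δ , c) = ↭-reflexive (map-++ (map₁ ρ) Γ Δ) , refl

uses : Atom n → List (MTy rank0) → Ctx n
uses a = map (a ,_)

bind : List (MTy rank0) → Res n → Res (suc n)
bind ts (Γ , b) = uses (inj₂ zero) ts ++ map (map₁ bump) Γ , b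

bind-≈ : {ts ts′ : List (MTy rank0)} {r r′ : Res n} → ts ↭ ts′ → r ≈ r′ → bind ts r ≈ bind ts′ r′
bind-≈ p (q , e) = ++⁺ (map⁺ _ p) (map⁺ _ q) , e

rename-uses : (ρ : Atom n → Atom m) (a : Atom n) (ts : List (MTy rank0)) →
              map (map₁ ρ) (uses a ts) ≡ uses (ρ a) ts
rename-uses ρ a ts = sym (map-∘ ts)

rename-∘ : (ρ : Atom m → Atom k) (ρ′ : Atom n → Atom m) (Γ : Ctx n) →
           map (map₁ ρ) (map (map₁ ρ′) Γ) ≡ map (map₁ (ρ ∘ ρ′)) Γ
rename-∘ ρ ρ′ Γ = sym (map-∘ Γ)

rename-cong : {ρ ρ′ : Atom n → Atom m} → ρ ≗ ρ′ → (Γ : Ctx n) →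
              map (map₁ ρ) Γ ≡ map (map₁ ρ′) Γ
rename-cong eq = map-cong (λ (a , t) → cong (_, t) (eq a))

rename-bind : (ρ : Atom n → Atom m) (ts : List (MTy rank0)) (r : Res n) →
              rename (lift ρ) (bind ts r) ≡ bind ts (rename ρ r)
rename-bind ρ ts (Γ , b) = cong (_, b) (begin
  map (map₁ (lift ρ)) (uses (inj₂ zero) ts ++ map (map₁ bump) Γ)
    ≡⟨ map-++ _ (uses (inj₂ zero) ts) _ ⟩
  map (map₁ (lift ρ)) (uses (inj₂ zero) ts) ++ map (map₁ (lift ρ)) (map (map₁ bump) Γ)
    ≡⟨ cong₂ _++_ (rename-uses (lift ρ) (inj₂ zero) ts) (begin
       map (map₁ (lift ρ)) (map (map₁ bump) Γ) ≡⟨ rename-∘ (lift ρ) bump Γ ⟩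
       map (map₁ (lift ρ ∘ bump)) Γ            ≡⟨ rename-cong (lift-bump ρ) Γ ⟩
       map (map₁ (bump ∘ ρ)) Γ                 ≡⟨ rename-∘ bump ρ Γ ⟨
       map (map₁ bump) (map (map₁ ρ) Γ)        ∎) ⟩
  uses (inj₂ zero) ts ++ map (map₁ bump) (map (map₁ ρ) Γ) ∎)
  where open ≡-Reasoning

-- The predicate is kept general for two uses: one argument typed with a list of types, and one
-- derivation for each entry of a context.
data Split {A : Set} (P : Res n → A → Set) : Res n → List A → Set where
  []  : ∀ {r} → r ≈ ε → Split P r []
  _∷⟨_⟩_ : ∀ {r r₁ r₂ x xs} → P r₁ x → r ≈ r₁ ∙ r₂ → Split P r₂ xs → Split P r (x ∷ xs)

module _ {A : Set} {P : Res n → A → Set} where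

  Split-≈ : ∀ {r r′ xs} → r ≈ r′ → Split P r xs → Split P r′ xs
  Split-≈ e ([] e′)        = [] (≈-trans (≈-sym e) e′)
  Split-≈ e (p ∷⟨ e′ ⟩ ps) = p ∷⟨ ≈-trans (≈-sym e) e′ ⟩ ps

  Split-++⁻ : ∀ xs {ys r} → Split P r (xs ++ ys) →
              ∃₂ λ r₁ r₂ → Split P r₁ xs × Split P r₂ ys × r ≈ r₁ ∙ r₂
  Split-++⁻ []       {r = r} ps = ε , r , [] ≈-refl , ps , ≈-sym (identityˡ r)
  Split-++⁻ (x ∷ xs) (_∷⟨_⟩_ {r₁ = r₀} p e ps) with Split-++⁻ xs ps
  ... | r₁ , r₂ , qs , qs′ , e′ =
    r₀ ∙ r₁ , r₂ , p ∷⟨ ≈-refl ⟩ qs , qs′ ,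
    ≈-trans e (≈-trans (∙-congˡ e′) (≈-sym (assoc r₀ r₁ r₂)))

  Split-++⁺ : ∀ {xs ys r₁ r₂} → Split P r₁ xs → Split P r₂ ys → Split P (r₁ ∙ r₂) (xs ++ ys)
  Split-++⁺ {r₂ = r₂} ([] e) qs = Split-≈ (≈-sym (≈-trans (∙-congʳ e) (identityˡ r₂))) qs
  Split-++⁺ {r₂ = r₂} (_∷⟨_⟩_ {r₁ = r₀} {r₂ = r₁} p e ps) qs =
    p ∷⟨ ≈-trans (∙-congʳ e) (assoc r₀ r₁ r₂) ⟩ Split-++⁺ ps qs

  Split-↭ : ∀ {r xs ys} → xs ↭ ys → Split P r xs → Split P r ys
  Split-↭ _↭_.refl ps = ps
  Split-↭ (prep x π) (p ∷⟨ e ⟩ ps) = p ∷⟨ e ⟩ Split-↭ π ps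
  Split-↭ (swap x y π) (_∷⟨_⟩_ {r₁ = r₁} p e (_∷⟨_⟩_ {r₁ = r₂} {r₂ = r₃} q e′ ps)) =
    q ∷⟨ ≈-trans e (≈-trans (∙-congˡ e′) (x∙yz≈y∙xz r₁ r₂ r₃)) ⟩ (p ∷⟨ ≈-refl ⟩ Split-↭ π ps)
  Split-↭ (_↭_.trans π π′) ps = Split-↭ π′ (Split-↭ π ps)

  Split-map⁺ : ∀ {B : Set} {f : B → A} {r} {xs : List B} →
               Split (λ r → P r ∘ f) r xs → Split P r (map f xs)
  Split-map⁺ ([] e)        = [] e
  Split-map⁺ (p ∷⟨ e ⟩ ps) = p ∷⟨ e ⟩ Split-map⁺ ps

-- Both kinds of arrow are read as a list of argument types with a codomain, the linear arrow having
-- a singleton list. One abstraction rule and one application rule then serve for both.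
data Arrow : MTy rank2 → List (MTy rank0) → MTy rank2 → Set where
  lin : ∀ {t s} → Arrow (t ⊸ s) (t ∷ []) s
  arr : ∀ {ts s} → Arrow (ts ⇒ s) (toList ts) s

Arrow-det : ∀ {a ts ts′ s s′} → Arrow a ts s → Arrow a ts′ s′ → ts ≡ ts′ × s ≡ s′
Arrow-det lin lin = refl , refl
Arrow-det arr arr = refl , refl

Arrow-¬tight : ∀ {a ts s} → Arrow a ts s → ¬ tight a
Arrow-¬tight lin ()
Arrow-¬tight arr ()

Arrow-conv : ∀ {a a′ ts s} → Arrow a ts s → a ≈ᵐ a′ →
             ∃₂ λ ts′ s′ → Arrow a′ ts′ s′ × ts ↭ ts′ × s ≈ᵐ s′
Arrow-conv lin (lin e)   = _ , _ , lin , ↭-refl , e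
Arrow-conv arr (arr π e) = _ , _ , arr , π , e

Arrow-codomain : ∀ {a ts s s′} → Arrow a ts s → s ≈ᵐ s′ → ∃[ a′ ] (Arrow a′ ts s′ × a ≈ᵐ a′)
Arrow-codomain lin e = _ , lin , lin e
Arrow-codomain arr e = _ , arr , arr ↭-refl e

-- Without intersections there is nothing to permute, so conversion cannot change the type of a
-- variable.
↑ᵐ-≈ : ∀ t {s} → ↑ᵐ t ≈ᵐ s → s ≡ ↑ᵐ t
↑ᵐ-≈ Neutral neu     = refl
↑ᵐ-≈ Abs     abs     = refl
↑ᵐ-≈ (‵ α)   var     = refl
↑ᵐ-≈ (t ⊸ u) (lin e) = cong (t ⊸_) (↑ᵐ-≈ u e)

infix 3 _⊢_∶_ _⊩_∶_

-- Both Γ₁ , Γ₂ and Γ₁ + Γ₂ become ∙, and contraction becomes a renaming.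
data _⊢_∶_ {n} : Res n → Term n → MTy rank2 → Set

_⊩_∶_ : Res n → Term n → List (MTy rank0) → Set
r ⊩ M ∶ ts = Split (λ r t → r ⊢ M ∶ ↑ᵐ t) r ts

data _⊢_∶_ {n} where
  fv   : ∀ {r x t s} → r ≈ ((inj₁ x , t) ∷ [] , 0) → s ≡ ↑ᵐ t → r ⊢ fv x ∶ s
  bv   : ∀ {r i t s} → r ≈ ((inj₂ i , t) ∷ [] , 0) → s ≡ ↑ᵐ t → r ⊢ bv i ∶ s
  lam  : ∀ {r r′ M a ts s} → Arrow a ts s → bind ts r ⊢ M ∶ s → r′ ≈ r ∙ steps 1 →
         r′ ⊢ lam M ∶ a
  lamₜ : ∀ {r r′ M ts s} → All tight ts → tight s → bind ts r ⊢ M ∶ s → r′ ≈ r →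
         r′ ⊢ lam M ∶ Abs
  app  : ∀ {r r₁ r₂ M N a ts s} → Arrow a ts s → r₁ ⊢ M ∶ a → r₂ ⊩ N ∶ ts → r ≈ r₁ ∙ r₂ →
         r ⊢ M · N ∶ s
  appₜ : ∀ {r r₁ r₂ M N s} → r₁ ⊢ M ∶ Neutral → r₂ ⊢ N ∶ s → tight s → r ≈ r₁ ∙ r₂ →
         r ⊢ M · N ∶ Neutral

-- Every rule states its resource up to `≈`, so the equivalence is absorbed by the last rule,
-- without induction.
⊢-≈ : ∀ {r r′ : Res n} {M s} → r ≈ r′ → r ⊢ M ∶ s → r′ ⊢ M ∶ s
⊢-≈ e (fv e′ eq)       = fv (≈-trans (≈-sym e) e′) eq
⊢-≈ e (bv e′ eq)       = bv (≈-trans (≈-sym e) e′) eq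
⊢-≈ e (lam A d e′)     = lam A d (≈-trans (≈-sym e) e′)
⊢-≈ e (lamₜ T t d e′)  = lamₜ T t d (≈-trans (≈-sym e) e′)
⊢-≈ e (app A d ds e′)  = app A d ds (≈-trans (≈-sym e) e′)
⊢-≈ e (appₜ d d′ t e′) = appₜ d d′ t (≈-trans (≈-sym e) e′)

⊢-atom : ∀ (a : Atom n) {r t} → r ≈ ((a , t) ∷ [] , 0) → r ⊢ atom a ∶ ↑ᵐ t
⊢-atom (inj₁ x) e = fv e refl
⊢-atom (inj₂ i) e = bv e refl

⊢-conv : ∀ {r : Res n} {M s s′} → s ≈ᵐ s′ → r ⊢ M ∶ s → r ⊢ M ∶ s′
⊢-conv e (fv {t = t} e′ refl) = fv e′ (↑ᵐ-≈ t e)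
⊢-conv e (bv {t = t} e′ refl) = bv e′ (↑ᵐ-≈ t e)
⊢-conv e (lam A d e′) with Arrow-conv A e
... | _ , _ , A′ , π , e″ = lam A′ (⊢-≈ (bind-≈ π ≈-refl) (⊢-conv e″ d)) e′
⊢-conv abs (lamₜ T t d e′) = lamₜ T t d e′
⊢-conv e (app A d ds e′) with Arrow-codomain A e
... | _ , A′ , e″ = app A′ (⊢-conv e″ d) ds e′
⊢-conv neu (appₜ d d′ t e′) = appₜ d d′ t e′

rename-split : (ρ : Atom n → Atom m) {r : Res n} (r₁ r₂ : Res n) → r ≈ r₁ ∙ r₂ →
               rename ρ r ≈ rename ρ r₁ ∙ rename ρ r₂
rename-split ρ r₁ r₂ e = ≈-trans (rename-≈ ρ e) (rename-∙ ρ r₁ r₂)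

-- Injectivity is not asked of `ρ`: contexts list one entry per occurrence, so atoms may be
-- identified without merging entries. Contraction is an instance.
⊢-ren : ∀ (ρ : Atom n → Atom m) {r M s} → r ⊢ M ∶ s → rename ρ r ⊢ ren ρ M ∶ s
⊩-ren : ∀ (ρ : Atom n → Atom m) {r M ts} → r ⊩ M ∶ ts → rename ρ r ⊩ ren ρ M ∶ ts

⊢-ren ρ (fv {x = x} e refl) = ⊢-atom (ρ (inj₁ x)) (rename-≈ ρ e)
⊢-ren ρ (bv {i = i} e refl) = ⊢-atom (ρ (inj₂ i)) (rename-≈ ρ e)
⊢-ren ρ (lam {r = r} {ts = ts} A d e) =
  lam A (subst (_⊢ _ ∶ _) (rename-bind ρ ts r) (⊢-ren (lift ρ) d)) (rename-split ρ r (steps 1) e)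
⊢-ren ρ (lamₜ {r = r} {ts = ts} T t d e) =
  lamₜ T t (subst (_⊢ _ ∶ _) (rename-bind ρ ts r) (⊢-ren (lift ρ) d)) (rename-≈ ρ e)
⊢-ren ρ (app {r₁ = r₁} {r₂} A d ds e) =
  app A (⊢-ren ρ d) (⊩-ren ρ ds) (rename-split ρ r₁ r₂ e)
⊢-ren ρ (appₜ {r₁ = r₁} {r₂} d d′ t e) =
  appₜ (⊢-ren ρ d) (⊢-ren ρ d′) t (rename-split ρ r₁ r₂ e)

⊩-ren ρ ([] e) = [] (rename-≈ ρ e)
⊩-ren ρ (_∷⟨_⟩_ {r₁ = r₁} {r₂} d e ds) = ⊢-ren ρ d ∷⟨ rename-split ρ r₁ r₂ e ⟩ ⊩-ren ρ ds

-- Substitution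

-- For each entry of the context, a derivation for the term that substitution puts in place of its
-- atom. Replaced and untouched atoms are thus handled by one induction.
Supply : Λ → Var → Res n → Ctx n → Set
Supply N x = Split (λ r (a , t) → r ⊢ atom a [ N / x ] ∶ ↑ᵐ t)

Supply-id : ∀ {N x} (Γ : Ctx n) → All (λ (a , _) → atom a [ N / x ] ≡ atom a) Γ →
            Supply N x (Γ , 0) Γ
Supply-id []            []         = [] ≈-refl
Supply-id ((a , t) ∷ Γ) (eq ∷ eqs) =
  subst (_ ⊢_∶ _) (sym eq) (⊢-atom a ≈-refl) ∷⟨ ≈-refl ⟩ Supply-id Γ eqs

Supply-bump : ∀ {N x r} {Γ : Ctx n} → Supply N x r Γ → Supply N x (rename bump r) (map (map₁ bump) Γ)
Supply-bump ([] e) = [] (rename-≈ bump e)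
Supply-bump {N = N} {x} (_∷⟨_⟩_ {r₁ = r₁} {r₂} {x = a , t} d e ds) =
  subst (_ ⊢_∶ _) (bump-[/] N x a) (⊢-ren bump d) ∷⟨ rename-split bump r₁ r₂ e ⟩ Supply-bump ds

Supply-bind : ∀ {N x r} {Γ : Ctx n} ts → Supply N x r Γ →
              Supply N x (bind ts r) (uses (inj₂ zero) ts ++ map (map₁ bump) Γ)
Supply-bind ts ds =
  Split-++⁺ (Supply-id (uses (inj₂ zero) ts) (All.map⁺ (All.universal (λ _ → refl) ts))) (Supply-bump ds)

bind-steps : ∀ ts (r : Res n) b → bind ts r ∙ steps b ≈ bind ts (r ∙ steps b)
bind-steps ts (Γ , c) b = ↭-reflexive
  (trans (++-identityʳ _) (cong (λ Δ → uses (inj₂ zero) ts ++ map (map₁ bump) Δ) (sym (++-identityʳ Γ)))) , refl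

Supply-++⁻ : ∀ {N x r} {Γ : Ctx n} Γ₁ {Γ₂} → Γ ↭ Γ₁ ++ Γ₂ → Supply N x r Γ →
             ∃₂ λ r₁ r₂ → Supply N x r₁ Γ₁ × Supply N x r₂ Γ₂ × r ≈ r₁ ∙ r₂
Supply-++⁻ Γ₁ π ds = Split-++⁻ Γ₁ (Split-↭ π ds)

split-steps : ∀ {r} (r₁ r₂ : Res n) {b} b₁ b₂ → r ≈ r₁ ∙ r₂ → b ≡ b₁ + b₂ →
              r ∙ steps b ≈ (r₁ ∙ steps b₁) ∙ (r₂ ∙ steps b₂)
split-steps r₁ r₂ b₁ b₂ e refl = ≈-trans (∙-congʳ e) (interchange r₁ r₂ (steps b₁) (steps b₂))

-- Each entry of `Γ` is consumed by exactly one variable occurrence, so the supply divides along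
-- with `Γ` at every rule, and its steps add to those of `M`.
⊢-[/] : ∀ N x {Γ : Ctx n} {b r M s} → (Γ , b) ⊢ M ∶ s → Supply N x r Γ →
        r ∙ steps b ⊢ M [ N / x ] ∶ s
⊩-[/] : ∀ N x {Γ : Ctx n} {b r M ts} → (Γ , b) ⊩ M ∶ ts → Supply N x r Γ →
        r ∙ steps b ⊩ M [ N / x ] ∶ ts

⊢-[/] N x {r = r} (fv (π , refl) refl) ds with Split-↭ π ds
... | _∷⟨_⟩_ {r₁ = r₁} d e ([] e′) =
  ⊢-≈ (≈-sym (≈-trans (identityʳ r) (≈-trans e (≈-trans (∙-congˡ e′) (identityʳ r₁))))) d
⊢-[/] N x {r = r} (bv (π , refl) refl) ds with Split-↭ π ds
... | _∷⟨_⟩_ {r₁ = r₁} d e ([] e′) =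
  ⊢-≈ (≈-sym (≈-trans (identityʳ r) (≈-trans e (≈-trans (∙-congˡ e′) (identityʳ r₁))))) d
⊢-[/] N x {r = r} (lam {r = Γ , b} {ts = ts} A d (π , refl)) ds =
  lam A (⊢-≈ (bind-steps ts r b) (⊢-[/] N x d (Supply-bind ts ds′))) (≈-sym (assoc r (steps b) (steps 1)))
  where ds′ = Split-↭ (↭-trans π (↭-reflexive (++-identityʳ Γ))) ds
⊢-[/] N x {r = r} (lamₜ {r = Γ , b} {ts = ts} T t d (π , refl)) ds =
  lamₜ T t (⊢-≈ (bind-steps ts r b) (⊢-[/] N x d (Supply-bind ts (Split-↭ π ds)))) ≈-refl
⊢-[/] N x (app {r₁ = Γ₁ , b₁} {r₂ = _ , b₂} A d es (π , e)) ds with Supply-++⁻ Γ₁ π ds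
... | r₁ , r₂ , ds₁ , ds₂ , e′ =
  app A (⊢-[/] N x d ds₁) (⊩-[/] N x es ds₂) (split-steps r₁ r₂ b₁ b₂ e′ e)
⊢-[/] N x (appₜ {r₁ = Γ₁ , b₁} {r₂ = _ , b₂} d d′ t (π , e)) ds with Supply-++⁻ Γ₁ π ds
... | r₁ , r₂ , ds₁ , ds₂ , e′ =
  appₜ (⊢-[/] N x d ds₁) (⊢-[/] N x d′ ds₂) t (split-steps r₁ r₂ b₁ b₂ e′ e)

⊩-[/] N x {r = r} ([] (π , refl)) ds with Split-↭ π ds
... | [] e = [] (≈-trans (identityʳ r) e)
⊩-[/] N x (_∷⟨_⟩_ {r₁ = Γ₁ , b₁} {r₂ = _ , b₂} d (π , e) es) ds with Supply-++⁻ Γ₁ π ds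
... | r₁ , r₂ , ds₁ , ds₂ , e′ =
  ⊢-[/] N x d ds₁ ∷⟨ split-steps r₁ r₂ b₁ b₂ e′ e ⟩ ⊩-[/] N x es ds₂

-- Substituting for, closing and opening a fresh name

FreshIn : Var → Ctx 0 → Set
FreshIn x = All (λ (a , _) → inj₁ x ≢ a)

eventuallyFreshIn : (Γ : Ctx 0) → ∃[ b ] (∀ x → b ≤ x → FreshIn x Γ)
eventuallyFreshIn [] = 0 , λ _ _ → []
eventuallyFreshIn ((inj₁ y , t) ∷ Γ) with eventuallyFreshIn Γ
... | b , f = suc y ⊔ b , λ x p →
  (λ { refl → ℕ.<-irrefl refl (ℕ.m⊔n≤o⇒m≤o (suc y) b p) }) ∷ f x (ℕ.m⊔n≤o⇒n≤o (suc y) b p)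

fv-[/]-≡ : ∀ (N : Λ) x → fv x [ N / x ] ≡ N
fv-[/]-≡ N x with x ≟ x
... | yes _  = refl
... | no x≢x = contradiction refl x≢x

fv-[/]-≢ : ∀ (N : Λ) {x} (a : Atom 0) → inj₁ x ≢ a → atom a [ N / x ] ≡ atom a
fv-[/]-≢ N {x} (inj₁ y) x≢y with x ≟ y
... | yes refl = contradiction refl x≢y
... | no  _    = refl

-- The derivations for `N` supply the entries of `x`; the entries of `Γ`, where `x` is fresh, supply
-- themselves at no cost.
⊢-β : ∀ {Γ x ts b M N r s} → FreshIn x Γ → (uses (inj₁ x) ts ++ Γ , b) ⊢ M ∶ s → r ⊩ N ∶ ts →
      (Γ , b) ∙ r ⊢ M [ N / x ] ∶ s
⊢-β {Γ} {x} {b = b} {N = N} {r} x♯Γ d ds =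
  ⊢-≈ (≈-trans (assoc r (Γ , 0) (steps b)) (≈-trans (comm r (Γ ++ [] , b)) (∙-congʳ {0} {r} (↭-reflexive (++-identityʳ Γ) , refl))))
      (⊢-[/] N x d (Split-++⁺ (Split-map⁺ (supply ds)) (Supply-id Γ (All.map (fv-[/]-≢ N _) x♯Γ))))
  where
  supply : ∀ {r ts} → r ⊩ N ∶ ts → Split (λ r t → r ⊢ fv x [ N / x ] ∶ ↑ᵐ t) r ts
  supply = subst (λ M → ∀ {r ts} → r ⊩ N ∶ ts → r ⊩ M ∶ ts) (sym (fv-[/]-≡ N x)) id

⊢-close : ∀ {Γ x ts b M s} → FreshIn x Γ → (uses (inj₁ x) ts ++ Γ , b) ⊢ M ∶ s →
          bind ts (Γ , b) ⊢ close x M ∶ s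
⊢-close {Γ} {x} {ts} {b} {M} x♯Γ d =
  subst₂ (_⊢_∶ _) (cong (_, b) eq) (sym (close-ren x M)) (⊢-ren (closeAtom x) d)
  where
  closeFresh : ∀ {Γ} → FreshIn x Γ → map (map₁ (closeAtom x)) Γ ≡ map (map₁ bump) Γ
  closeFresh [] = refl
  closeFresh {(inj₁ y , t) ∷ _} (x≢y ∷ x♯Γ) =
    cong₂ _∷_ (cong (_, t) (closeAtom-≢ (x≢y ∘ cong inj₁))) (closeFresh x♯Γ)
  eq : map (map₁ (closeAtom x)) (uses (inj₁ x) ts ++ Γ) ≡ uses (inj₂ zero) ts ++ map (map₁ bump) Γ
  eq = trans (map-++ _ (uses (inj₁ x) ts) Γ) (cong₂ _++_
    (trans (rename-uses (closeAtom x) (inj₁ x) ts) (cong (λ a → uses a ts) (closeAtom-≡ x)))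
    (closeFresh x♯Γ))

⊢-open : ∀ {Γ ts b M s} x → bind ts (Γ , b) ⊢ M ∶ s →
         (uses (inj₁ x) ts ++ Γ , b) ⊢ ren (openAtom x) M ∶ s
⊢-open {Γ} {ts} {b} x d = subst (_⊢ _ ∶ _) (cong (_, b) eq) (⊢-ren (openAtom x) d)
  where
  openBump : ∀ Γ → map (map₁ (openAtom x)) (map (map₁ bump) Γ) ≡ Γ
  openBump [] = refl
  openBump ((inj₁ y , t) ∷ Γ) = cong (_ ∷_) (openBump Γ)
  eq : map (map₁ (openAtom x)) (uses (inj₂ zero) ts ++ map (map₁ bump) Γ) ≡ uses (inj₁ x) ts ++ Γ
  eq = trans (map-++ _ (uses (inj₂ zero) ts) _)
    (cong₂ _++_ (rename-uses (openAtom x) (inj₂ zero) ts) (openBump Γ))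

-- Evaluation and normality speak of named abstractions `ƛ x M`. Matching on this view puts an
-- arbitrary body into the form `close x M` with `x` fresh for the context, together with the
-- transfer of typing and size.
data Opening (Γ : Ctx 0) : Term 1 → Set where
  opening : ∀ {x M} → FreshIn x Γ →
            (∀ {ts b s} → bind ts (Γ , b) ⊢ close x M ∶ s → (uses (inj₁ x) ts ++ Γ , b) ⊢ M ∶ s) →
            size M ≡ size (close x M) → Opening Γ (close x M)

open-body : ∀ Γ M → Opening Γ M
open-body Γ M with eventuallyFresh M | eventuallyFreshIn Γ
... | b , f | c , g = subst (Opening Γ) eq (opening (g x (ℕ.m≤n⊔m b c))
    (λ {ts} {b} d → ⊢-open {ts = ts} x (subst (bind ts (Γ , b) ⊢_∶ _) eq d))
    (trans (size-ren (openAtom x) M) (cong size (sym eq))))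
  where
  x = b ⊔ c
  eq = close-open x M (f x (ℕ.m≤m⊔n b c))

-- Evaluation of tightly typed terms

TightCtx : Ctx 0 → Set
TightCtx = All (λ (_ , t) → tight t)

tight-↑ᵐ : ∀ {t} → tight t → tight (↑ᵐ t)
tight-↑ᵐ neu = neu
tight-↑ᵐ abs = abs

-- The tightness recorded by `finished` rules out a normal term of arrow type in function position.
data Progress (Γ : Ctx 0) (b : ℕ) (M : Λ) (s : MTy rank2) : Set where
  finished : normal M → b ≡ 0 → tight s → (s ≡ Neutral → neutral M) → Progress Γ b M s
  stepped  : ∀ {b′ M′} → M ⟶ M′ → b ≡ suc b′ → (Γ , b′) ⊢ M′ ∶ s → Progress Γ b M s

lam-or-not : ∀ M → (∃[ M′ ] M ≡ lam M′) ⊎ ¬ IsAbs M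
lam-or-not (fv x)  = inj₂ λ ()
lam-or-not (lam M) = inj₁ (M , refl)
lam-or-not (M · N) = inj₂ λ ()

Neutral-¬IsAbs : ∀ {r M} → r ⊢ M ∶ Neutral → ¬ IsAbs M
Neutral-¬IsAbs (lam () d e) (_ , _ , refl)

-- An abstraction of arrow type must come from `lam`, and the single step charged by that rule pays
-- for this contraction.
⊢-contract : ∀ {Γ₁ b₁ Γ₂ b₂ a ts s N} M → Arrow a ts s → (Γ₁ , b₁) ⊢ lam M ∶ a → (Γ₂ , b₂) ⊩ N ∶ ts →
             ∃₂ λ M′ b₁′ → lam M · N ⟶ M′ × b₁ ≡ suc b₁′ × (Γ₁ ++ Γ₂ , b₁′ + b₂) ⊢ M′ ∶ s
⊢-contract M () (lamₜ _ _ _ _) ds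
⊢-contract M A (lam {r = Γ , b} A′ d (π , refl)) ds with Arrow-det A A′ | open-body Γ M
... | refl , refl | opening {x} {M₁} x♯Γ o _ =
  _ , b , β {x} {M₁} , ℕ.+-comm b 1 ,
  ⊢-≈ (++⁺ʳ _ (↭-sym (↭-trans π (↭-reflexive (++-identityʳ Γ)))) , refl) (⊢-β x♯Γ (o d) ds)

-- Tightness of `s` is asked of abstractions only, so that the induction can enter a function part
-- that has an arrow type but is no abstraction. The bound `k` is the induction measure because an
-- opened body is not a subterm.
progress : ∀ k M {Γ b s} → size M ≤ k → TightCtx Γ → (IsAbs M → tight s) → (Γ , b) ⊢ M ∶ s →
           Progress Γ b M s
progress k (fv x) _ Γt _ (fv (π , b≡0) refl) with All-resp-↭ π Γt
... | t ∷ [] = finished (ne var) b≡0 (tight-↑ᵐ t) (λ _ → var)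
progress (suc k) (lam M) {Γ} (s≤s M≤k) Γt absTight d with open-body Γ M
progress (suc k) (lam _) (s≤s M≤k) Γt absTight (lam A _ _) | opening {x} {M} _ _ _ =
  contradiction (absTight (x , M , refl)) (Arrow-¬tight A)
-- By `lamₜ` the entries of the bound variable are tight, so the opened body is again tightly typed.
progress (suc k) (lam _) (s≤s M≤k) Γt absTight (lamₜ T t d e) | opening {M = M} x♯Γ o eq
  with progress k M (ℕ.≤-trans (ℕ.≤-reflexive eq) M≤k) (All.++⁺ (All.map⁺ T) Γt) (λ _ → t)
         (o (⊢-≈ (bind-≈ ↭-refl (≈-sym e)) d))
... | finished nf b≡0 _ _ = finished (abs nf) b≡0 abs λ ()
... | stepped M⟶M′ b≡ d′  = stepped (ξ M⟶M′) b≡ (lamₜ T t (⊢-close x♯Γ d′) ≈-refl)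
progress (suc k) (M · N) (s≤s p) Γt _ (app {r₁ = Γ₁ , b₁} {r₂ = _ , b₂} A d ds (π , refl)) with lam-or-not M
... | inj₁ (M₀ , refl) with ⊢-contract M₀ A d ds
...   | _ , _ , M⟶M′ , b≡ , d′ = stepped M⟶M′ (cong (_+ b₂) b≡) (⊢-≈ (↭-sym π , refl) d′)
progress (suc k) (M · N) (s≤s p) Γt _ (app {r₁ = Γ₁ , b₁} {r₂ = _ , b₂} A d ds (π , refl)) | inj₂ ¬abs
  with progress k M (ℕ.m+n≤o⇒m≤o _ p) (All.++⁻ˡ Γ₁ (All-resp-↭ π Γt)) (λ M-abs → contradiction M-abs ¬abs) d
-- A finished function part would have a type that is both tight and an arrow.
... | finished _ _ t _   = contradiction t (Arrow-¬tight A)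
... | stepped M⟶M′ b≡ d′ = stepped (μ M⟶M′ ¬abs) (cong (_+ b₂) b≡) (app A d′ ds (π , refl))
progress (suc k) (M · N) (s≤s p) Γt _ (appₜ {r₁ = Γ₁ , b₁} {r₂ = _ , b₂} d d′ t (π , refl))
  with progress k M (ℕ.m+n≤o⇒m≤o _ p) (All.++⁻ˡ Γ₁ (All-resp-↭ π Γt)) (λ _ → neu) d
... | stepped M⟶M′ b≡ d₁ =
  stepped (μ M⟶M′ (Neutral-¬IsAbs d)) (cong (_+ b₂) b≡) (appₜ d₁ d′ t (π , refl))
-- The function part is neutral with counter 0, so evaluation moves to the argument, which holds all
-- remaining steps.
... | finished _ refl _ neutral-M
  with progress k N (ℕ.m+n≤o⇒n≤o (size M) p) (All.++⁻ʳ Γ₁ (All-resp-↭ π Γt)) (λ _ → t) d′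
...   | finished nf b≡0 _ _ = finished (ne (app (neutral-M refl) nf)) b≡0 neu (λ _ → app (neutral-M refl) nf)
...   | stepped N⟶N′ b≡ d₂ = stepped (ν (neutral-M refl) N⟶N′) b≡ (appₜ d d₂ t (π , refl))

evaluate : ∀ b {Γ M s} → TightCtx Γ → tight s → (Γ , b) ⊢ M ∶ s →
           ∃[ N ] (M ⟶[ b ] N × normal N × (s ≡ Neutral → neutral N))
evaluate b {M = M} Γt t d with progress (size M) M ℕ.≤-refl Γt (λ _ → t) d
... | finished nf refl _ neutral-M = M , done , nf , neutral-M
... | stepped M⟶M′ refl d′ with evaluate _ Γt t d′
...   | N , M′⟶N , nf = N , step M⟶M′ M′⟶N , nf

-- Consistency of derivable environments

Unique-↭ : {xs ys : List Var} → xs ↭ ys → Unique xs → Unique ys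
Unique-↭ π = PermSetoid.Unique-resp-↭ (setoid Var) (↭⇒↭ₛ π)

Unique-++⁻ˡ : (xs : List Var) {ys : List Var} → Unique (xs ++ ys) → Unique xs
Unique-++⁻ˡ []       _          = []
Unique-++⁻ˡ (x ∷ xs) (x∉ ∷ uxs) = All.++⁻ˡ xs x∉ ∷ Unique-++⁻ˡ xs uxs

dom-≈ᵉ : ∀ {Γ Γ′} → Γ ≈ᵉ Γ′ → dom Γ ≡ dom Γ′
dom-≈ᵉ []                = refl
dom-≈ᵉ (decl {x} _ _ ∷ e) = cong (x ∷_) (dom-≈ᵉ e)

Consistent-prefix : ∀ Γ {Δ} → Consistent (Γ ++ Δ) → Consistent Γ
Consistent-prefix Γ u = Unique-++⁻ˡ (dom Γ) (subst Unique (map-++ name Γ _) u)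

-- Distinct names are what make sums flatten to concatenations and make an abstracted or contracted
-- variable absent from the rest of the environment.
consistent : ∀ {Γ b M σ s} → Γ ⊢[ b ] M ∶⟨ σ , s ⟩ → Consistent Γ
consistent (conv e _ _ Φ)             = subst Unique (dom-≈ᵉ e) (consistent Φ)
consistent axiom                      = [] ∷ []
consistent (exchange {Γ₁} {d₁ = d₁} {d₂} Φ) =
  Unique-↭ (map⁺ name (++⁺ˡ Γ₁ (swap d₁ d₂ ↭-refl))) (consistent Φ)
consistent (contraction _ u)          = u
consistent (⊸-intro {Γ} Φ)            = Consistent-prefix Γ (consistent Φ)
consistent (⊸-introₜ {Γ} Φ _ _)       = Consistent-prefix Γ (consistent Φ)
consistent (→-intro {Γ = Γ} Φ)        = Consistent-prefix Γ (consistent Φ)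
consistent (→-introₜ {Γ = Γ} Φ _ _)   = Consistent-prefix Γ (consistent Φ)
consistent (⊸-elim _ _ u)             = u
consistent (⊸-elimₜ _ _ _ u)          = u
consistent (→-elim _ _ u)             = u
consistent (→-elimₜ _ _ _ u)          = u

fresh? : (Γ : Env) (d : Decl) → Dec (name d ∉ dom Γ)
fresh? Γ d = ¬? (_∈?_ _≟_ (name d) (dom Γ))

extend-name : ∀ Γ d → name (extend Γ d) ≡ name d
extend-name Γ (x ∶ _ , _) with find x Γ
... | just _  = refl
... | nothing = refl

dom-extend : ∀ Γ Δ → dom (map (extend Δ) Γ) ≡ dom Γ
dom-extend Γ Δ = trans (sym (map-∘ Γ)) (map-cong (extend-name Δ) Γ)

⊕-consistent : ∀ Γ Δ → Consistent Γ → Consistent Δ → Consistent (Γ ⊕ Δ)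
⊕-consistent Γ Δ uΓ uΔ = subst Unique
  (sym (trans (map-++ name (map (extend Δ) Γ) (filter (fresh? Γ) Δ))
              (cong (_++ dom (filter (fresh? Γ) Δ)) (dom-extend Γ Δ))))
  (Unique.++⁺ uΓ (AllPairs.map⁺ (AllPairs.filter⁺ (fresh? Γ) (AllPairs.map⁻ uΔ))) disjoint)
  where
  disjoint : ∀ {x} → ¬ (x ∈ dom Γ × x ∈ dom (filter (fresh? Γ) Δ))
  disjoint (x∈Γ , x∈Δ) with ∈-map⁻ name x∈Δ
  ... | d , d∈ , refl = proj₂ (∈-filter⁻ (fresh? Γ) {xs = Δ} d∈) x∈Γ

∑-consistent : ∀ {k} (Γs : Vec Env k) → (∀ i → Consistent (lookup Γs i)) → Consistent (∑ Γs)
∑-consistent []       _ = []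
∑-consistent (Γ ∷ Γs) u = ⊕-consistent Γ (∑ Γs) (u zero) (∑-consistent Γs (u ∘ suc))

-- Environments as contexts

occurrences : Decl → Ctx 0
occurrences (x ∶ _ , ts) = uses (inj₁ x) (toList ts)

flatten : Env → Ctx 0
flatten = concatMap occurrences

flatten-++ : ∀ Γ Δ → flatten (Γ ++ Δ) ≡ flatten Γ ++ flatten Δ
flatten-++ = concatMap-++ occurrences

flatten-≈ᵉ : ∀ {Γ Γ′} → Γ ≈ᵉ Γ′ → flatten Γ ↭ flatten Γ′
flatten-≈ᵉ []             = ↭-refl
flatten-≈ᵉ (decl _ π ∷ e) = ++⁺ (map⁺ _ π) (flatten-≈ᵉ e)

flatten-↭ : ∀ {Γ Γ′} → Γ ↭ Γ′ → flatten Γ ↭ flatten Γ′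
flatten-↭ _↭_.refl       = ↭-refl
flatten-↭ (prep d π)     = ++⁺ˡ (occurrences d) (flatten-↭ π)
flatten-↭ (swap d d′ π) =
  ↭-trans (shifts (occurrences d) (occurrences d′))
          (++⁺ˡ (occurrences d′) (++⁺ˡ (occurrences d) (flatten-↭ π)))
flatten-↭ (_↭_.trans π π′) = ↭-trans (flatten-↭ π) (flatten-↭ π′)

flatten-tight : ∀ {Γ} → tightEnv Γ → TightCtx (flatten Γ)
flatten-tight []                 = []
flatten-tight {(_ ∶ _ , _) ∷ _} (t ∷ ts) = All.++⁺ (All.map⁺ t) (flatten-tight ts)

find-∉ : ∀ {x} Γ → All (x ≢_) (dom Γ) → find x Γ ≡ nothing
find-∉ []                _ = refl
find-∉ {x} ((y ∶ _ , _) ∷ Γ) (x≢y ∷ x∉) with x ≟ y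
... | yes x≡y = contradiction x≡y x≢y
... | no  _   = find-∉ Γ x∉

extend-≢ : ∀ e Δ d → name d ≢ name e → extend (e ∷ Δ) d ≡ extend Δ d
extend-≢ (y ∶ _ , _) Δ (x ∶ _ , _) x≢y with x ≟ y
... | yes x≡y = contradiction x≡y x≢y
... | no  _   = refl

extend-∉ : ∀ e Δ Γ → All (name e ≢_) (dom Γ) → map (extend (e ∷ Δ)) Γ ≡ map (extend Δ) Γ
extend-∉ e Δ []      _          = refl
extend-∉ e Δ (d ∷ Γ) (e≢d ∷ e∉) = cong₂ _∷_ (extend-≢ e Δ d (e≢d ∘ sym)) (extend-∉ e Δ Γ e∉)

occurrences-extend : ∀ e Δ d → name d ≡ name e → All (name e ≢_) (dom Δ) →
                     occurrences (extend (e ∷ Δ) d) ↭ occurrences e ++ occurrences (extend Δ d)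
occurrences-extend (x ∶ _ , us) Δ (x ∶ _ , ts) refl x∉Δ with x ≟ x
... | no x≢x = contradiction refl x≢x
... | yes _ rewrite find-∉ Δ x∉Δ =
  ↭-trans (↭-reflexive (map-++ _ (toList ts) (toList us))) (Perm.++-comm (uses (inj₁ x) (toList ts)) _)

-- By consistency exactly one declaration of `Γ` has the name of `e`, so the entries of `e` are
-- inserted once.
flatten-extend : ∀ e Δ Γ → name e ∈ dom Γ → Consistent Γ → All (name e ≢_) (dom Δ) →
                 flatten (map (extend (e ∷ Δ)) Γ) ↭ occurrences e ++ flatten (map (extend Δ) Γ)
flatten-extend e Δ (d ∷ Γ) (here eq) (d∉Γ ∷ _) e∉Δ =
  ↭-trans (++⁺ (occurrences-extend e Δ d (sym eq) e∉Δ)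
               (↭-reflexive (cong flatten (extend-∉ e Δ Γ (subst (λ x → All (x ≢_) _) (sym eq) d∉Γ)))))
          (Perm.++-assoc (occurrences e) _ _)
flatten-extend e Δ (d ∷ Γ) (there e∈Γ) (d∉Γ ∷ u) e∉Δ =
  ↭-trans (++⁺ (↭-reflexive (cong occurrences (extend-≢ e Δ d (All.lookup d∉Γ e∈Γ))))
               (flatten-extend e Δ Γ e∈Γ u e∉Δ))
          (shifts (occurrences (extend Δ d)) (occurrences e))

-- By induction on `Δ`: each of its declarations is either merged into one of `Γ` or kept by the
-- filter, never both.
flatten-⊕ : ∀ Γ Δ → Consistent Γ → Consistent Δ → flatten (Γ ⊕ Δ) ↭ flatten Γ ++ flatten Δ
flatten-⊕ Γ Δ uΓ uΔ = ↭-trans (↭-reflexive (flatten-++ (map (extend Δ) Γ) _)) (go Δ uΔ)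
  where
  go : ∀ Δ → Consistent Δ →
       flatten (map (extend Δ) Γ) ++ flatten (filter (fresh? Γ) Δ) ↭ flatten Γ ++ flatten Δ
  go []      _ = ↭-reflexive (cong (λ Γ → flatten Γ ++ []) (trans (map-cong extend-[] Γ) (map-id Γ)))
    where
    extend-[] : ∀ d → extend [] d ≡ d
    extend-[] (_ ∶ _ , _) = refl
  go (e ∷ Δ) (e∉Δ ∷ u) with _∈?_ _≟_ (name e) (dom Γ)
  ... | yes e∈Γ =
    ↭-trans (++⁺ʳ _ (flatten-extend e Δ Γ e∈Γ uΓ e∉Δ))
    (↭-trans (Perm.++-assoc (occurrences e) _ _)
    (↭-trans (++⁺ˡ (occurrences e) (go Δ u)) (shifts (occurrences e) (flatten Γ))))
  ... | no  e∉Γ =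
    ↭-trans (++⁺ʳ _ (↭-reflexive (cong flatten (extend-∉ e Δ Γ (All.¬Any⇒All¬ _ e∉Γ)))))
    (↭-trans (shifts (flatten (map (extend Δ) Γ)) (occurrences e))
    (↭-trans (++⁺ˡ (occurrences e) (go Δ u)) (shifts (occurrences e) (flatten Γ))))

-- The linear types of rank 0 at neutral targets

-- Only codomains are inspected, because the domain of `⊸` has rank 0 by its index.
Linear : LinTy rank2 → Set
Linear (‵ α)    = ⊤
Linear (τ ⊸ σ)  = Linear σ
Linear (τs ⇒ σ) = ⊥

-- Both types are followed along matching arrows; if the multi-type ends in `Neutral`, the linear
-- type left over must have rank 0. This condition passes to codomains, as the elimination rules
-- require.
Compatible : LinTy rank2 → MTy rank2 → Set
Compatible σ        Neutral  = Linear σ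
Compatible (τ ⊸ σ)  (t ⊸ s)  = Compatible σ s
Compatible (τs ⇒ σ) (ts ⇒ s) = Compatible σ s
Compatible _        _        = ⊤

Linear-↑ˡ : ∀ τ → Linear (↑ˡ τ)
Linear-↑ˡ (‵ α)   = tt
Linear-↑ˡ (τ ⊸ σ) = Linear-↑ˡ σ

Compatible-↑ : ∀ τ t → Compatible (↑ˡ τ) (↑ᵐ t)
Compatible-↑ τ       Neutral = Linear-↑ˡ τ
Compatible-↑ (‵ _)   Abs     = tt
Compatible-↑ (_ ⊸ _) Abs     = tt
Compatible-↑ (‵ _)   (‵ _)   = tt
Compatible-↑ (_ ⊸ _) (‵ _)   = tt
Compatible-↑ (‵ _)   (_ ⊸ _) = tt
Compatible-↑ (_ ⊸ τ) (_ ⊸ t) = Compatible-↑ τ t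

Linear-≈ : ∀ {σ σ′} → σ ≈ˡ σ′ → Linear σ → Linear σ′
Linear-≈ var     _ = tt
Linear-≈ (lin e) l = Linear-≈ e l

Compatible-≈ : ∀ {σ σ′ s s′} → σ ≈ˡ σ′ → s ≈ᵐ s′ → Compatible σ s → Compatible σ′ s′
Compatible-≈ e         neu       c = Linear-≈ e c
Compatible-≈ var       abs       c = tt
Compatible-≈ (lin _)   abs       c = tt
Compatible-≈ (arr _ _) abs       c = tt
Compatible-≈ var       var       c = tt
Compatible-≈ (lin _)   var       c = tt
Compatible-≈ (arr _ _) var       c = tt
Compatible-≈ var       (lin _)   c = tt
Compatible-≈ (lin e)   (lin e′)  c = Compatible-≈ e e′ c
Compatible-≈ (arr _ _) (lin _)   c = tt
Compatible-≈ var       (arr _ _) c = tt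
Compatible-≈ (lin _)   (arr _ _) c = tt
Compatible-≈ (arr _ e) (arr _ e′) c = Compatible-≈ e e′ c

compatible : ∀ {Γ b M σ s} → Γ ⊢[ b ] M ∶⟨ σ , s ⟩ → Compatible σ s
compatible (conv _ e e′ Φ)     = Compatible-≈ e e′ (compatible Φ)
compatible (axiom {τ = τ} {t}) = Compatible-↑ τ t
compatible (exchange Φ)        = compatible Φ
compatible (contraction Φ _)   = compatible Φ
compatible (⊸-intro Φ)         = compatible Φ
compatible (⊸-introₜ _ _ _)    = tt
compatible (→-intro Φ)         = compatible Φ
compatible (→-introₜ _ _ _)    = tt
compatible (⊸-elim Φ _ _)      = compatible Φ
compatible (⊸-elimₜ Φ _ _ _)   = compatible Φ
compatible (→-elim Φ _ _)      = compatible Φ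
-- The head pairs `Neutral` with an intersection arrow, where `Compatible` is empty.
compatible (→-elimₜ Φ _ _ _)   = ⊥-elim (compatible Φ)

-- Forgetting the linear types

replace-≡ : ∀ x y → replace x y y ≡ x
replace-≡ x y with y ≟ y
... | yes _  = refl
... | no y≢y = contradiction refl y≢y

replace-≢ : ∀ x {y z} → y ≢ z → replace x y z ≡ z
replace-≢ x {y} {z} y≢z with y ≟ z
... | yes y≡z = contradiction y≡z y≢z
... | no  _   = refl

-- Contraction may reuse one of the contracted names: the second replacement keeps `x` even if `x`
-- is the name being replaced.
replace-self : ∀ x y → replace x y x ≡ x
replace-self x y with y ≟ x
... | yes _ = refl
... | no  _ = refl

contractAtom : Var → Var → Var → Atom 0 → Atom 0
contractAtom x x₁ x₂ = replaceAtom x x₂ ∘ replaceAtom x x₁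

flatten-contract : ∀ {x x₁ x₂} Γ → All (x₁ ≢_) (dom Γ) → All (x₂ ≢_) (dom Γ) →
                   map (map₁ (contractAtom x x₁ x₂)) (flatten Γ) ≡ flatten Γ
flatten-contract [] _ _ = refl
flatten-contract {x} {x₁} {x₂} ((y ∶ _ , ts) ∷ Γ) (x₁≢y ∷ x₁∉) (x₂≢y ∷ x₂∉) =
  trans (map-++ _ (uses (inj₁ y) (toList ts)) (flatten Γ))
    (cong₂ _++_ (trans (rename-uses _ (inj₁ y) (toList ts)) (cong (λ z → uses (inj₁ z) (toList ts))
                  (trans (cong (replace x x₂) (replace-≢ x x₁≢y)) (replace-≢ x x₂≢y))))
                (flatten-contract Γ x₁∉ x₂∉))

⊢-contraction : ∀ Γ₁ {Γ₂ x x₁ x₂ τs₁ τs₂ ts₁ ts₂ b M s} →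
  Consistent (Γ₁ ++ (x₁ ∶ τs₁ , ts₁) ∷ (x₂ ∶ τs₂ , ts₂) ∷ Γ₂) →
  (flatten (Γ₁ ++ (x₁ ∶ τs₁ , ts₁) ∷ (x₂ ∶ τs₂ , ts₂) ∷ Γ₂) , b) ⊢ M ∶ s →
  (flatten (Γ₁ ++ (x ∶ τs₁ ∩ τs₂ , ts₁ ∩ ts₂) ∷ Γ₂) , b) ⊢ M [ fv x / x₁ ] [ fv x / x₂ ] ∶ s
⊢-contraction Γ₁ {Γ₂} {x} {x₁} {x₂} {τs₁} {τs₂} {ts₁} {ts₂} {b} {M} u d
  with Unique-↭ (map⁺ name (shifts Γ₁ ((x₁ ∶ τs₁ , ts₁) ∷ (x₂ ∶ τs₂ , ts₂) ∷ []))) u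
-- With the two declarations moved to the front, consistency shows that the renaming affects their
-- entries only.
... | (x₁≢x₂ ∷ x₁∉) ∷ x₂∉ ∷ _ =
  subst (_ ⊢_∶ _) eqM (⊢-≈ (π , refl) (⊢-ren ρ (⊢-≈ (flatten-↭ (shifts Γ₁ (_ ∷ _ ∷ [])) , refl) d)))
  where
  ρ = contractAtom x x₁ x₂
  us = toList ts₁
  vs = toList ts₂
  eqM : ren ρ M ≡ M [ fv x / x₁ ] [ fv x / x₂ ]
  eqM = sym (trans (cong _[ fv x / x₂ ] (replace-ren x x₁ M))
    (trans (replace-ren x x₂ (ren (replaceAtom x x₁) M)) (ren-∘ _ _ M)))
  eq : map (map₁ ρ) (uses (inj₁ x₁) us ++ uses (inj₁ x₂) vs ++ flatten (Γ₁ ++ Γ₂)) ≡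
       uses (inj₁ x) us ++ uses (inj₁ x) vs ++ flatten (Γ₁ ++ Γ₂)
  eq = trans (map-++ _ (uses (inj₁ x₁) us) _) (cong₂ _++_
    (trans (rename-uses ρ (inj₁ x₁) us)
           (cong (λ z → uses (inj₁ z) us) (trans (cong (replace x x₂) (replace-≡ x x₁)) (replace-self x x₂))))
    (trans (map-++ _ (uses (inj₁ x₂) vs) _) (cong₂ _++_
      (trans (rename-uses ρ (inj₁ x₂) vs)
             (cong (λ z → uses (inj₁ z) vs)
                   (trans (cong (replace x x₂) (replace-≢ x x₁≢x₂)) (replace-≡ x x₂))))
      (flatten-contract (Γ₁ ++ Γ₂) x₁∉ x₂∉))))
  π : map (map₁ ρ) (uses (inj₁ x₁) us ++ uses (inj₁ x₂) vs ++ flatten (Γ₁ ++ Γ₂)) ↭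
      flatten (Γ₁ ++ (x ∶ τs₁ ∩ τs₂ , ts₁ ∩ ts₂) ∷ Γ₂)
  π = ↭-trans (↭-reflexive (trans eq (sym (trans (cong (_++ flatten (Γ₁ ++ Γ₂)) (map-++ _ us vs)) (++-assoc (uses (inj₁ x) us) _ _)))))
    (↭-sym (flatten-↭ (shift (x ∶ τs₁ ∩ τs₂ , ts₁ ∩ ts₂) Γ₁ Γ₂)))

⊢-abstract : ∀ {Γ x τs ts b M s} → Consistent (Γ ++ (x ∶ τs , ts) ∷ []) →
             (flatten (Γ ++ (x ∶ τs , ts) ∷ []) , b) ⊢ M ∶ s →
             bind (toList ts) (flatten Γ , b) ⊢ close x M ∶ s
⊢-abstract {Γ} {x} {τs} {ts} u d with Unique-↭ (map⁺ name (Perm.++-comm Γ ((x ∶ τs , ts) ∷ []))) u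
... | x∉Γ ∷ _ = ⊢-close (fresh Γ x∉Γ) (⊢-≈ (flatten-↭ (Perm.++-comm Γ ((x ∶ τs , ts) ∷ [])) , refl) d)
  where
  fresh : ∀ Γ → All (x ≢_) (dom Γ) → FreshIn x (flatten Γ)
  fresh []                 _          = []
  fresh ((_ ∶ _ , us) ∷ Γ) (x≢y ∷ x∉) =
    All.++⁺ (All.map⁺ (All.universal (λ { _ refl → x≢y refl }) (toList us))) (fresh Γ x∉)

toList-fromVec : ∀ {A : Set} {k} (xs : Vec A (suc k)) → toList (fromVec xs) ≡ Vec.toList xs
toList-fromVec (x ∷ xs) = refl

⊩-∑ : ∀ {k M} (Γs : Vec Env k) (bs : Vec ℕ k) (ts : Vec (MTy rank0) k) →
      (∀ i → Consistent (lookup Γs i)) →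
      (∀ i → (flatten (lookup Γs i) , lookup bs i) ⊢ M ∶ ↑ᵐ (lookup ts i)) →
      (flatten (∑ Γs) , Vec.sum bs) ⊩ M ∶ Vec.toList ts
⊩-∑ []       []       []       _ _ = [] ≈-refl
⊩-∑ (Γ ∷ Γs) (b ∷ bs) (t ∷ ts) u d =
  d zero ∷⟨ flatten-⊕ Γ (∑ Γs) (u zero) (∑-consistent Γs (u ∘ suc)) , refl ⟩
  ⊩-∑ Γs bs ts (u ∘ suc) (d ∘ suc)

tick : ∀ (Γ : Ctx n) b → (Γ , suc b) ≈ (Γ , b) ∙ steps 1
tick Γ b = ↭-reflexive (sym (++-identityʳ Γ)) , ℕ.+-comm 1 b

flatten-split : ∀ Γ Δ b c → (flatten (Γ ++ Δ) , b + c) ≈ (flatten Γ , b) ∙ (flatten Δ , c)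
flatten-split Γ Δ b c = ↭-reflexive (flatten-++ Γ Δ) , refl

-- Exchange becomes a permutation of entries and contraction a renaming, and the linear and
-- intersection rules merge through `Arrow`. The rule `→-elimₜ` is excluded by `compatible`.
erase : ∀ {Γ b M σ s} → Γ ⊢[ b ] M ∶⟨ σ , s ⟩ → (flatten Γ , b) ⊢ M ∶ s
erase (conv e _ e′ Φ)            = ⊢-conv e′ (⊢-≈ (flatten-≈ᵉ e , refl) (erase Φ))
erase axiom                      = fv ≈-refl refl
erase (exchange {Γ₁} {d₁ = d₁} {d₂} Φ) =
  ⊢-≈ (flatten-↭ (++⁺ˡ Γ₁ (swap d₁ d₂ ↭-refl)) , refl) (erase Φ)
erase (contraction {Γ₁} Φ _)     = ⊢-contraction Γ₁ (consistent Φ) (erase Φ)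
erase (⊸-intro Φ)                = lam lin (⊢-abstract (consistent Φ) (erase Φ)) (tick _ _)
erase (⊸-introₜ Φ t t′)          = lamₜ (t ∷ []) t′ (⊢-abstract (consistent Φ) (erase Φ)) ≈-refl
erase (→-intro Φ)                = lam arr (⊢-abstract (consistent Φ) (erase Φ)) (tick _ _)
erase (→-introₜ Φ ts t)          = lamₜ ts t (⊢-abstract (consistent Φ) (erase Φ)) ≈-refl
erase (⊸-elim {Γ₁} {Γ₂} {b₁} {b₂} Φ Ψ _) =
  app lin (erase Φ) (erase Ψ ∷⟨ ≈-sym (identityʳ (flatten Γ₂ , b₂)) ⟩ [] ≈-refl) (flatten-split Γ₁ Γ₂ b₁ b₂)
erase (⊸-elimₜ {Γ₁} {Γ₂} {b₁} {b₂} Φ Ψ t _) = appₜ (erase Φ) (erase Ψ) t (flatten-split Γ₁ Γ₂ b₁ b₂)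
erase (→-elim {Γ = Γ} {b} {ts = ts} {Γs} {bs} Φ Ψ _) =
  app arr (erase Φ)
    (subst (_ ⊩ _ ∶_) (sym (toList-fromVec ts)) (⊩-∑ Γs bs ts (consistent ∘ Ψ) (erase ∘ Ψ)))
    (flatten-split Γ (∑ Γs) b (Vec.sum bs))
erase (→-elimₜ Φ _ _ _)          = ⊥-elim (compatible Φ)

theorem49 : ∀ {Γ : Env} {b : ℕ} {M : Λ} {σ : LinTy rank2} {s : MTy rank2}
    (Φ : Γ ⊢[ b ] M ∶⟨ σ , s ⟩) → TightDerivation Φ →
    ∃[ N ] (M ⟶[ b ] N × normal N × (s ≡ Neutral → neutral N))
theorem49 Φ (t , Γt) = evaluate _ (flatten-tight Γt) t (erase Φ)
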